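{- Let $\lambda\geq 1$ be an integer and let $L$ be a frequency square of type $F(2\lambda;\lambda,\lambda)$. Then $L$ has a balanced diagonal, unless $\lambda$ is odd and $L$ is equivalent to $A_{2\lambda}$.
   Context: Write $N(k)=\{1,2,\dots,k\}$. Rows and columns of an $n\times n$ array are indexed by $N(n)$, and $L_{i,j}$ denotes the entry of $L$ in cell $(i,j)$. An array is identified with its set of triples $(i,j;L_{i,j})$. A frequency square of type $F(2\lambda;\lambda,\lambda)$ is a $2\lambda\times 2\lambda$ array with entries from $\{1,2\}$ in which each of the two symbols occurs exactly $\lambda$ times in each row and exactly $\lambda$ times in each column. A diagonal of a square array is a set of cells that uses each row and each column exactly once. A diagonal of such a frequency square is balanced if each of the symbols $1,2$ occurs in exactly $\lambda$ of its cells. Two such frequency squares are equivalent if one can be obtained from the other by rearranging rows, rearranging columns, relabelling symbols, and/or taking the transpose. The frequency square $A_{2\lambda}$ is $$A_{2\lambda}=\{(i,j;1),\ (i+\lambda,j+\lambda;1),\ (i,j+\lambda;2),\ (i+\lambda,j;2)\mid i,j\in N(\lambda)\}.$$ -}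

module Defs where

open import Data.Fin using (Fin; zero; suc; splitAt)
open import Data.Fin.Permutation using (Permutation′; _⟨$⟩ʳ_)
open import Data.Fin.Properties using (_≟_)
open import Data.Nat using (ℕ; _*_)
open import Data.Nat.Divisibility using (_∣_)
open import Data.Product using (∃-syntax)
open import Data.Sum using (_⊎_; inj₁; inj₂)
open import Data.Vec using (count; tabulate)
open import Relation.Binary.Construct.Closure.ReflexiveTransitive using (Star)
open import Relation.Binary.PropositionalEquality using (_≡_)
open import Relation.Nullary using (¬_)

Odd : ℕ → Set
Odd n = ¬ (2 ∣ n)

Symbol : Set
Symbol = Fin 2

pattern s₁ = zero
pattern s₂ = suc zero

Array : ℕ → Set
Array n = Fin n → Fin n → Symbol

occurrences : ∀ {n} → Symbol → (Fin n → Symbol) → ℕ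
occurrences s f = count (_≟ s) (tabulate f)

record IsFrequencySquare (l : ℕ) (L : Array (2 * l)) : Set where
  field
    rows    : ∀ i s → occurrences s (λ j → L i j) ≡ l
    columns : ∀ j s → occurrences s (λ i → L i j) ≡ l

-- A set of cells using each row and each column exactly once is the graph
-- { (i , π i) } of a permutation π.
Diagonal : ℕ → Set
Diagonal n = Permutation′ n

Balanced : ∀ l → Array (2 * l) → Diagonal (2 * l) → Set
Balanced l L π = ∀ s → occurrences s (λ i → L i (π ⟨$⟩ʳ i)) ≡ l

HasBalancedDiagonal : ∀ l → Array (2 * l) → Set
HasBalancedDiagonal l L = ∃[ π ] Balanced l L π

-- Entries are compared pointwise because arrays are functions.
data Step {n : ℕ} (L M : Array n) : Set where
  rearrangeRows    : (ρ : Permutation′ n) →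
                     (∀ i j → M i j ≡ L (ρ ⟨$⟩ʳ i) j) → Step L M
  rearrangeColumns : (γ : Permutation′ n) →
                     (∀ i j → M i j ≡ L i (γ ⟨$⟩ʳ j)) → Step L M
  relabelSymbols   : (σ : Permutation′ 2) →
                     (∀ i j → M i j ≡ σ ⟨$⟩ʳ (L i j)) → Step L M
  transpose        : (∀ i j → M i j ≡ L j i) → Step L M

-- Every step is reversible, so this is an equivalence relation.
Equivalent : ∀ {n} → Array n → Array n → Set
Equivalent = Star Step

blockEntry : {X Y : Set} → X ⊎ Y → X ⊎ Y → Symbol
blockEntry (inj₁ _) (inj₁ _) = s₁
blockEntry (inj₁ _) (inj₂ _) = s₂
blockEntry (inj₂ _) (inj₁ _) = s₂
blockEntry (inj₂ _) (inj₂ _) = s₁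

-- splitAt l separates the first l indices from the remaining l; it applies
-- because 2 * l reduces to l + (l + 0).
A : ∀ l → Array (2 * l)
A l i j = blockEntry (splitAt l i) (splitAt l j)

-- If L has a 2 × 2 subarray with an odd number of symbols 1, its two diagonals
-- differ by exactly 1 in the number of 1s they carry. Averaging shows that
-- the other rows and columns have diagonals with at least and with at most the
-- required number of 1s; passing between them by transpositions moves the
-- count by at most 2, so it cannot jump over both of the two admissible
-- values. Otherwise L i j = r i + c j mod 2, which is A up to rearrangement,
-- and every diagonal carries an even number of each symbol: the same
-- search then succeeds when l is even, and nothing can when l is odd.
module Submission where

open import Defs
open import Data.Fin using (Fin; zero; suc; toℕ; punchIn; splitAt)
open import Data.Fin.Permutation
  using (Permutation′; _⟨$⟩ʳ_; _⟨$⟩ˡ_; id; _∘ₚ_; flip; lift₀; swap; permutation; inverseʳ; inverseˡ)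
  renaming (transpose to transposition)
open import Data.Fin.Properties using (_≟_; any?; all?; punchInᵢ≢i)
open import Data.Nat using (ℕ; zero; suc; _+_; _*_; _∸_; _≤_; _<_; _≤?_; _<?_; z≤n; s≤s)
open import Data.Nat.Divisibility
open import Data.Nat.Properties hiding (_≟_)
import Data.Nat.Properties as ℕ
open import Data.Nat.Tactic.RingSolver using (solve-∀)
open import Data.Product using (_×_; _,_; ∃-syntax)
open import Data.Sum using (_⊎_; inj₁; inj₂)
import Data.Sum as Sum
open import Data.Vec.Functional using (updateAt)
open import Data.Vec.Functional.Properties using (updateAt-updates; updateAt-minimal)
open import Function using (_∘_; const; case_of_)
open import Relation.Binary.Construct.Closure.ReflexiveTransitive using (ε; _◅_)
open import Relation.Binary.PropositionalEquality
open import Relation.Nullary using (¬_; Dec; yes; no; does; contradiction)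
open import Relation.Nullary.Decidable using (from-yes; ¬?; _→-dec_; decidable-stable)
open import Data.Bool using (if_then_else_)

open import Algebra.Properties.Semiring.Sum +-*-semiring
  using (sum; sum-cong-≗; sum-remove; sum-permute; ∑-comm; ∑-distrib-+)

-- Finite sums of natural numbers

sum-const : ∀ n c → sum {n} (const c) ≡ n * c
sum-const zero    c = refl
sum-const (suc n) c = cong (c +_) (sum-const n c)

sum-mono-≤ : ∀ {n} {f g : Fin n → ℕ} → (∀ i → f i ≤ g i) → sum f ≤ sum g
sum-mono-≤ {zero}  f≤g = z≤n
sum-mono-≤ {suc n} f≤g = +-mono-≤ (f≤g zero) (sum-mono-≤ (f≤g ∘ suc))

-- Each side is the common sum over the indices other than `i`, plus `f i + g i`; the additive form
-- avoids truncated subtraction.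
sum-change₁ : ∀ {n} {f g : Fin n → ℕ} i → (∀ k → k ≢ i → f k ≡ g k) →
              sum f + g i ≡ sum g + f i
sum-change₁ {suc n} {f} {g} i f≗g = begin
  sum f + g i                ≡⟨ cong (_+ g i) (sum-remove {i = i} f) ⟩
  f i + rest f + g i         ≡⟨ cong (λ r → f i + r + g i)
                                  (sum-cong-≗ (λ k → f≗g _ (punchInᵢ≢i i k))) ⟩
  f i + rest g + g i         ≡⟨ reverse (f i) (rest g) (g i) ⟩
  g i + rest g + f i         ≡⟨ cong (_+ f i) (sum-remove {i = i} g) ⟨
  sum g + f i                ∎
  where
  open ≡-Reasoning
  rest : (Fin (suc n) → ℕ) → ℕ
  rest h = sum (h ∘ punchIn i)
  reverse : ∀ a b c → a + b + c ≡ c + b + a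
  reverse = solve-∀

sum-change₂ : ∀ {n} {f g : Fin n → ℕ} {i j} → i ≢ j →
              (∀ k → k ≢ i → k ≢ j → f k ≡ g k) →
              sum f + (g i + g j) ≡ sum g + (f i + f j)
sum-change₂ {n} {f} {g} {i} {j} i≢j f≗g = begin
  sum f + (g i + g j)  ≡⟨ shuffle (sum f) (g i) (g j) ⟩
  sum f + g j + g i    ≡⟨ cong (λ x → sum f + x + g i) h-j ⟨
  sum f + h j + g i    ≡⟨ cong (_+ g i) (sum-change₁ j f≗h) ⟩
  sum h + f j + g i    ≡⟨ swap-last (sum h) (f j) (g i) ⟩
  sum h + g i + f j    ≡⟨ cong (_+ f j) (sum-change₁ i (λ k k≢i → updateAt-minimal k i g k≢i)) ⟩
  sum g + h i + f j    ≡⟨ cong (λ x → sum g + x + f j) (updateAt-updates i g) ⟩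
  sum g + f i + f j    ≡⟨ +-assoc (sum g) (f i) (f j) ⟩
  sum g + (f i + f j)  ∎
  where
  open ≡-Reasoning
  -- `h` interpolates: it can differ from `g` only at `i` and from `f` only at `j`.
  h : Fin n → ℕ
  h = updateAt g i (const (f i))
  h-j : h j ≡ g j
  h-j = updateAt-minimal j i g (i≢j ∘ sym)
  f≗h : ∀ k → k ≢ j → f k ≡ h k
  f≗h k k≢j with k ≟ i
  ... | yes refl = sym (updateAt-updates i g)
  ... | no  k≢i  = trans (f≗g k k≢i k≢j) (sym (updateAt-minimal k i g k≢i))
  shuffle : ∀ a b c → a + (b + c) ≡ a + c + b
  shuffle = solve-∀
  swap-last : ∀ a b c → a + b + c ≡ a + c + b
  swap-last = solve-∀

-- Action of a transposition

transposition-left : ∀ {n} (i j : Fin n) → transposition i j ⟨$⟩ʳ i ≡ j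
transposition-left i j with i ≟ i
... | yes _  = refl
... | no i≢i = contradiction refl i≢i

transposition-right : ∀ {n} (i j : Fin n) → transposition i j ⟨$⟩ʳ j ≡ i
transposition-right i j with j ≟ i
... | yes j≡i = j≡i
... | no _ with j ≟ j
...   | yes _  = refl
...   | no j≢j = contradiction refl j≢j

transposition-other : ∀ {n} (i j : Fin n) {k} → k ≢ i → k ≢ j → transposition i j ⟨$⟩ʳ k ≡ k
transposition-other i j {k} k≢i k≢j with k ≟ i
... | yes k≡i = contradiction k≡i k≢i
... | no _ with k ≟ j
...   | yes k≡j = contradiction k≡j k≢j
...   | no _    = refl

-- Weights of diagonals and their average

Weights : ℕ → Set
Weights m = Fin m → Fin m → ℕ

total : ∀ {m} → Weights m → ℕ
total W = sum (λ i → sum (W i))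

-- For a 0/1 array marking one symbol, this counts that symbol on the diagonal `π`.
weight : ∀ {m} → Weights m → Permutation′ m → ℕ
weight W π = sum (λ i → W i (π ⟨$⟩ʳ i))

-- Composing with the transposition exchanges the columns used by rows `i` and `j` and leaves the
-- other cells of the diagonal alone.
weight-transposition : ∀ {m} (W : Weights m) π {i j} → i ≢ j →
  weight W (transposition i j ∘ₚ π) + (W i (π ⟨$⟩ʳ i) + W j (π ⟨$⟩ʳ j)) ≡
  weight W π + (W i (π ⟨$⟩ʳ j) + W j (π ⟨$⟩ʳ i))
weight-transposition W π {i} {j} i≢j = begin
  weight W (τ ∘ₚ π) + (W i (π ⟨$⟩ʳ i) + W j (π ⟨$⟩ʳ j))
    ≡⟨ sum-change₂ i≢j (λ k k≢i k≢j →
         cong (λ x → W k (π ⟨$⟩ʳ x)) (transposition-other i j k≢i k≢j)) ⟩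
  weight W π + (W i (π ⟨$⟩ʳ (τ ⟨$⟩ʳ i)) + W j (π ⟨$⟩ʳ (τ ⟨$⟩ʳ j)))
    ≡⟨ cong₂ (λ x y → weight W π + (W i (π ⟨$⟩ʳ x) + W j (π ⟨$⟩ʳ y)))
         (transposition-left i j) (transposition-right i j) ⟩
  weight W π + (W i (π ⟨$⟩ʳ j) + W j (π ⟨$⟩ʳ i)) ∎
  where
  open ≡-Reasoning
  τ = transposition i j

-- Summing the hypothesis over all i and j gives 2 total ≤ 2 m weight.
unimprovable⇒total≤ : ∀ {m} (W : Weights m) π →
  (∀ i j → W i (π ⟨$⟩ʳ j) + W j (π ⟨$⟩ʳ i) ≤ W i (π ⟨$⟩ʳ i) + W j (π ⟨$⟩ʳ j)) →
  total W ≤ m * weight W π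
unimprovable⇒total≤ {m} W π max = *-cancelˡ-≤ 2 (begin
  2 * total W
    ≡⟨ cong (total W +_) (+-identityʳ (total W)) ⟩
  total W + total W
    ≡⟨ cong₂ _+_ (sum-cong-≗ (λ i → sum-permute (W i) π))
                 (trans (∑-comm W) (sum-permute (λ j → sum (λ i → W i j)) π)) ⟩
  sum (λ i → sum (λ j → W i (π ⟨$⟩ʳ j))) + sum (λ i → sum (λ j → W j (π ⟨$⟩ʳ i)))
    ≡⟨ double-∑-distrib-+ (λ i j → W i (π ⟨$⟩ʳ j)) (λ i j → W j (π ⟨$⟩ʳ i)) ⟨
  sum (λ i → sum (λ j → W i (π ⟨$⟩ʳ j) + W j (π ⟨$⟩ʳ i)))
    ≤⟨ sum-mono-≤ (λ i → sum-mono-≤ (max i)) ⟩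
  sum (λ i → sum (λ j → d i + d j))
    ≡⟨ double-∑-distrib-+ (λ i j → d i) (λ i j → d j) ⟩
  sum (λ i → sum {m} (λ j → d i)) + sum {m} (λ i → sum d)
    ≡⟨ cong (_+ sum {m} (λ i → sum d)) (∑-comm {m} {m} (λ i j → d i)) ⟩
  sum {m} (λ i → sum d) + sum {m} (λ i → sum d)
    ≡⟨ cong (λ x → x + x) (sum-const m (sum d)) ⟩
  m * sum d + m * sum d
    ≡⟨ cong (m * sum d +_) (+-identityʳ (m * sum d)) ⟨
  2 * (m * weight W π) ∎)
  where
  open ≤-Reasoning
  d : Fin m → ℕ
  d i = W i (π ⟨$⟩ʳ i)
  double-∑-distrib-+ : (f g : Weights m) →
    sum (λ i → sum (λ j → f i j + g i j)) ≡ total f + total g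
  double-∑-distrib-+ f g =
    trans (sum-cong-≗ (λ i → ∑-distrib-+ (f i) (g i)))
          (∑-distrib-+ (λ i → sum (f i)) (λ i → sum (g i)))

-- Local search for a diagonal of nearly prescribed weight

-- Two adjacent values are allowed; the last unit is settled later, by the choice of a corner
-- diagonal or by parity.
Near : ∀ {m} → Weights m → ℕ → Set
Near W t = ∃[ π ] (t ≤ weight W π × weight W π ≤ suc t)

module _ {m} {W : Weights m} (W≤1 : ∀ i j → W i j ≤ 1) where

  -- A transposition changes the weight by at most 2, so ascending never
  -- jumps over both t and t + 1.
  ascend : ∀ {t} → m * t < total W + m → ∀ fuel π →
           t ≤ fuel + weight W π → weight W π ≤ suc t → Near W t
  ascend {t} mt<T+m fuel π t≤ ≤t+1 with t ≤? weight W π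
  ... | yes t≤w = π , t≤w , ≤t+1
  ascend mt<T+m zero π t≤ ≤t+1 | no t≰w = contradiction t≤ t≰w
  ascend {t} mt<T+m (suc fuel) π t≤ ≤t+1 | no t≰w
    with any? (λ i → any? (λ j →
           W i (π ⟨$⟩ʳ i) + W j (π ⟨$⟩ʳ j) <? W i (π ⟨$⟩ʳ j) + W j (π ⟨$⟩ʳ i)))
  -- At a local maximum of weight below `t`, averaging gives `total W ≤ m * (t - 1)`. The hypothesis
  -- denies this, with `m` moved across to avoid subtraction.
  ... | no ¬better = contradiction mt<T+m (≤⇒≯ (begin
    total W + m              ≤⟨ +-monoˡ-≤ m (unimprovable⇒total≤ W π
                                   (λ i j → ≮⇒≥ (λ lt → ¬better (i , j , lt)))) ⟩
    m * weight W π + m       ≡⟨ +-comm _ m ⟩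
    m + m * weight W π       ≡⟨ *-suc m (weight W π) ⟨
    m * suc (weight W π)     ≤⟨ *-monoʳ-≤ m (≰⇒> t≰w) ⟩
    m * t                    ∎))
    where open ≤-Reasoning
  ... | yes (i , j , old<new) = ascend mt<T+m fuel π′
    -- Every exchange gains at least 1, which pays for the unit of fuel spent; a gain of at most 2
    -- from below `t` stays within `t + 1`.
    (≤-trans t≤ (≤-trans (≤-reflexive (sym (+-suc fuel w))) (+-monoʳ-≤ fuel w<w′)))
    (≤-trans w′≤w+2 (s≤s (≰⇒> t≰w)))
    where
    open ≤-Reasoning
    π′ = transposition i j ∘ₚ π
    w = weight W π
    w′ = weight W π′
    old = W i (π ⟨$⟩ʳ i) + W j (π ⟨$⟩ʳ j)
    new = W i (π ⟨$⟩ʳ j) + W j (π ⟨$⟩ʳ i)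
    i≢j : i ≢ j
    i≢j refl = <-irrefl refl old<new
    w<w′ : w < w′
    w<w′ = +-cancelʳ-< old w w′ (begin-strict
      w + old   <⟨ +-monoʳ-< w old<new ⟩
      w + new   ≡⟨ weight-transposition W π i≢j ⟨
      w′ + old  ∎)
    w′≤w+2 : w′ ≤ 2 + w
    w′≤w+2 = begin
      w′        ≤⟨ m≤m+n w′ old ⟩
      w′ + old  ≡⟨ weight-transposition W π i≢j ⟩
      w + new   ≤⟨ +-monoʳ-≤ w (+-mono-≤ (W≤1 _ _) (W≤1 _ _)) ⟩
      w + 2     ≡⟨ +-comm w 2 ⟩
      2 + w     ∎

-- Passing to the complement turns a descent in weight into an ascent.
complement : ∀ {m} → Weights m → Weights m
complement W i j = 1 ∸ W i j

module _ {m} {W : Weights m} (W≤1 : ∀ i j → W i j ≤ 1) where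

  weight-complement : ∀ π → weight (complement W) π + weight W π ≡ m
  weight-complement π = begin
    weight (complement W) π + weight W π
      ≡⟨ ∑-distrib-+ {m} _ _ ⟨
    sum (λ i → complement W i (π ⟨$⟩ʳ i) + W i (π ⟨$⟩ʳ i))
      ≡⟨ sum-cong-≗ (λ i → m∸n+n≡m (W≤1 i _)) ⟩
    sum {m} (λ i → 1)
      ≡⟨ trans (sum-const m 1) (*-identityʳ m) ⟩
    m ∎
    where open ≡-Reasoning

  total-complement : total (complement W) + total W ≡ m * m
  total-complement = begin
    total (complement W) + total W
      ≡⟨ ∑-distrib-+ {m} _ _ ⟨
    sum (λ i → sum (complement W i) + sum (W i))
      ≡⟨ sum-cong-≗ (λ i → trans (sym (∑-distrib-+ {m} _ _))
           (trans (sum-cong-≗ (λ j → m∸n+n≡m (W≤1 i j))) (trans (sum-const m 1) (*-identityʳ m)))) ⟩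
    sum {m} (λ i → m)
      ≡⟨ sum-const m m ⟩
    m * m ∎
    where open ≡-Reasoning

  -- The hypotheses place the average diagonal weight `total W / m` strictly between `t - 1` and
  -- `t + 2`. A start of weight at most `t + 1` ascends; a heavier one ascends in the complement,
  -- where the weights `u` and `u + 1` correspond to `t + 1` and `t`.
  near-exists : ∀ t → m * t < total W + m → total W < m * (2 + t) → Near W t
  near-exists t mt<T+m T<m[t+2] with weight W id ≤? suc t
  ... | yes w≤t+1 = ascend W≤1 mt<T+m t id (m≤m+n t _) w≤t+1
  ... | no  w≰t+1 = back (ascend {W = complement W}
                      (λ i j → m∸n≤m 1 (W i j)) mu<T′+m u id (m≤m+n u _)
                      (m≤n⇒m≤1+n (lower id (≤-trans (n≤1+n _) (≰⇒> w≰t+1)))))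
    where
    open ≤-Reasoning
    u = m ∸ suc t
    u+1+t≡m : u + suc t ≡ m
    u+1+t≡m = m∸n+n≡m (begin
      suc t        ≤⟨ n≤1+n _ ⟩
      2 + t        ≤⟨ ≰⇒> w≰t+1 ⟩
      weight W id  ≤⟨ m≤n+m _ _ ⟩
      weight (complement W) id + weight W id ≡⟨ weight-complement id ⟩
      m            ∎)
    balance : ∀ π → weight (complement W) π + weight W π ≡ u + suc t
    balance π = trans (weight-complement π) (sym u+1+t≡m)
    lower : ∀ π → suc t ≤ weight W π → weight (complement W) π ≤ u
    lower π t<w = +-cancelʳ-≤ (suc t) _ _ (begin
      weight (complement W) π + suc t       ≤⟨ +-monoʳ-≤ _ t<w ⟩
      weight (complement W) π + weight W π  ≡⟨ balance π ⟩
      u + suc t                             ∎)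
    -- The upper bound on `total W` becomes the lower bound that `ascend` needs for the complement.
    mu<T′+m : m * u < total (complement W) + m
    mu<T′+m = +-cancelʳ-< (m * suc t) _ _ (begin-strict
      m * u + m * suc t                ≡⟨ *-distribˡ-+ m u (suc t) ⟨
      m * (u + suc t)                  ≡⟨ cong (m *_) u+1+t≡m ⟩
      m * m                            ≡⟨ total-complement ⟨
      total (complement W) + total W   <⟨ +-monoʳ-< _ T<m[t+2] ⟩
      total (complement W) + m * (2 + t) ≡⟨ cong (total (complement W) +_) (*-suc m (suc t)) ⟩
      total (complement W) + (m + m * suc t) ≡⟨ +-assoc (total (complement W)) m (m * suc t) ⟨
      total (complement W) + m + m * suc t ∎)
    back : Near (complement W) u → Near W t
    back (π , u≤w′ , w′≤u+1) = π ,
      +-cancelˡ-≤ (suc u) _ _ (begin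
        suc u + t                             ≡⟨ +-suc u t ⟨
        u + suc t                             ≡⟨ balance π ⟨
        weight (complement W) π + weight W π  ≤⟨ +-monoˡ-≤ _ w′≤u+1 ⟩
        suc u + weight W π                    ∎) ,
      +-cancelˡ-≤ u _ _ (begin
        u + weight W π                        ≤⟨ +-monoˡ-≤ _ u≤w′ ⟩
        weight (complement W) π + weight W π  ≡⟨ balance π ⟩
        u + suc t                             ∎)

-- Arrays with an odd 2 × 2 subarray

-- The remainder R of W beyond its top left 2 × 2 corner has order 2t and
-- total 2t² − 1, so some diagonal of R has weight t or t + 1; exactly one of
-- the two diagonals of the corner completes it to weight t + 1.
odd-corner⇒diagonal : ∀ t (W : Weights (2 + 2 * t)) → (∀ i j → W i j ≤ 1) →
  (∀ i → sum (W i) ≡ suc t) → (∀ j → sum (λ i → W i j) ≡ suc t) →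
  (W zero zero + W zero (suc zero)) + (W (suc zero) zero + W (suc zero) (suc zero)) ≡ 1 →
  ∃[ π ] weight W π ≡ suc t
-- For `t = 0` the corner is the whole array and sums to 2, not 1.
odd-corner⇒diagonal zero W W≤1 rows cols corner≡1 = contradiction
  (trans (sym (cong₂ _+_ (row zero) (row (suc zero)))) corner≡1) λ ()
  where
  row : ∀ i → W i zero + W i (suc zero) ≡ 1
  row i = trans (cong (W i zero +_) (sym (+-identityʳ _))) (rows i)
odd-corner⇒diagonal t@(suc t-1) W W≤1 rows cols corner≡1 = complete
  (near-exists (λ i j → W≤1 (suc (suc i)) (suc (suc j))) t mt<T+m T<m[t+2])
  where
  m = 2 * t
  R : Weights m
  R i j = W (suc (suc i)) (suc (suc j))
  w₀₀ = W zero zero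
  w₀₁ = W zero (suc zero)
  w₁₀ = W (suc zero) zero
  w₁₁ = W (suc zero) (suc zero)
  c₀ c₁ : Fin m → ℕ
  c₀ i = W (suc (suc i)) zero
  c₁ i = W (suc (suc i)) (suc zero)
  C₀ = sum c₀
  C₁ = sum c₁
  lower-rows : C₀ + (C₁ + total R) ≡ m * suc t
  lower-rows = begin
    C₀ + (C₁ + total R)
      ≡⟨ cong (C₀ +_) (∑-distrib-+ c₁ (λ i → sum (R i))) ⟨
    C₀ + sum (λ i → c₁ i + sum (R i))
      ≡⟨ ∑-distrib-+ c₀ (λ i → c₁ i + sum (R i)) ⟨
    sum (λ i → sum (W (suc (suc i))))
      ≡⟨ trans (sum-cong-≗ (λ i → rows (suc (suc i)))) (sum-const m (suc t)) ⟩
    m * suc t ∎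
    where open ≡-Reasoning
  -- The first two columns sum to `2 * suc t`, of which the corner takes 1; the other `2 * t + 1`
  -- are removed from the `m * suc t` of the lower rows.
  total-R : suc (total R) ≡ m * t
  total-R = +-cancelʳ-≡ (suc (2 * t)) _ _ (begin
    suc (total R) + suc (2 * t)
      ≡⟨ e₁ (total R) t ⟩
    total R + (suc t + suc t)
      ≡⟨ cong (total R +_) (cong₂ _+_ (cols zero) (cols (suc zero))) ⟨
    total R + ((w₀₀ + (w₁₀ + C₀)) + (w₀₁ + (w₁₁ + C₁)))
      ≡⟨ e₂ (total R) w₀₀ w₀₁ w₁₀ w₁₁ C₀ C₁ ⟩
    C₀ + (C₁ + total R) + ((w₀₀ + w₀₁) + (w₁₀ + w₁₁))
      ≡⟨ cong₂ _+_ lower-rows corner≡1 ⟩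
    m * suc t + 1
      ≡⟨ e₃ t ⟩
    m * t + suc (2 * t) ∎)
    where
    open ≡-Reasoning
    e₁ : ∀ x t → suc x + suc (2 * t) ≡ x + (suc t + suc t)
    e₁ = solve-∀
    e₂ : ∀ x a b c d y z → x + ((a + (c + y)) + (b + (d + z))) ≡ y + (z + x) + ((a + b) + (c + d))
    e₂ = solve-∀
    e₃ : ∀ t → 2 * t * suc t + 1 ≡ 2 * t * t + suc (2 * t)
    e₃ = solve-∀
  mt<T+m : m * t < total R + m
  mt<T+m = begin-strict
    m * t          ≡⟨ total-R ⟨
    1 + total R    ≡⟨ +-comm 1 (total R) ⟩
    total R + 1    <⟨ +-monoʳ-< (total R) (*-monoʳ-≤ 2 (s≤s z≤n)) ⟩
    total R + m    ∎
    where open ≤-Reasoning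
  T<m[t+2] : total R < m * (2 + t)
  T<m[t+2] = ≤-trans (≤-reflexive total-R) (*-monoʳ-≤ m (m≤n+m t 2))
  one-diagonal : ∀ a b c d → (a + b) + (c + d) ≡ 1 →
    (a + d ≡ 1 × b + c ≡ 0) ⊎ (a + d ≡ 0 × b + c ≡ 1)
  one-diagonal zero    zero    zero    d       eq   = inj₁ (eq , refl)
  one-diagonal zero    zero    (suc c) d       eq
    with refl ← m+n≡0⇒m≡0 c (suc-injective eq) | refl ← m+n≡0⇒n≡0 c (suc-injective eq) = inj₂ (refl , refl)
  one-diagonal zero    (suc zero) zero zero    eq   = inj₂ (refl , refl)
  one-diagonal (suc zero) zero zero    zero    eq   = inj₁ (refl , refl)
  complete : Near R t → ∃[ π ] weight W π ≡ suc t
  complete (σ , t≤v , v≤t+1) with t ≤? weight R σ | weight R σ ≤? t | one-diagonal w₀₀ w₀₁ w₁₀ w₁₁ corner≡1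
  ... | no t≰v | _       | _                       = contradiction t≤v t≰v
  -- A remainder of weight `t` needs 1 from the corner, one of weight `t + 1` needs 0.
  -- `lift₀ (lift₀ σ)` uses the main diagonal of the corner, `swap σ` the other one.
  ... | yes _  | yes v≤t | inj₁ (diag≡1 , _)       = lift₀ (lift₀ σ) ,
    trans (sym (+-assoc w₀₀ w₁₁ _)) (cong₂ _+_ diag≡1 (≤-antisym v≤t t≤v))
  ... | yes _  | yes v≤t | inj₂ (_ , anti≡1)       = swap σ ,
    trans (sym (+-assoc w₀₁ w₁₀ _)) (cong₂ _+_ anti≡1 (≤-antisym v≤t t≤v))
  ... | yes _  | no v≰t  | inj₁ (_ , anti≡0)       = swap σ ,
    trans (sym (+-assoc w₀₁ w₁₀ _)) (cong₂ _+_ anti≡0 (≤-antisym v≤t+1 (≰⇒> v≰t)))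
  ... | yes _  | no v≰t  | inj₂ (diag≡0 , _)       = lift₀ (lift₀ σ) ,
    trans (sym (+-assoc w₀₀ w₁₁ _)) (cong₂ _+_ diag≡0 (≤-antisym v≤t+1 (≰⇒> v≰t)))

-- Carries a diagonal of the rearranged array back to `W`: the cell `(i , π i)` comes from
-- `(ρ i , γ (π i))`, so reindexing rows by `ρ` matches the sums.
weight-rearrange : ∀ {m} (W : Weights m) (ρ γ π : Permutation′ m) →
  weight W (flip ρ ∘ₚ π ∘ₚ γ) ≡ weight (λ i j → W (ρ ⟨$⟩ʳ i) (γ ⟨$⟩ʳ j)) π
weight-rearrange W ρ γ π = trans
  (sum-permute (λ i → W i ((flip ρ ∘ₚ π ∘ₚ γ) ⟨$⟩ʳ i)) ρ)
  (sum-cong-≗ (λ i → cong (λ x → W (ρ ⟨$⟩ʳ i) (γ ⟨$⟩ʳ (π ⟨$⟩ʳ x))) (inverseˡ ρ)))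

-- Row `suc i` and column `suc j` are brought to index 1 while row and column 0 stay fixed, which
-- makes the odd square the corner. `n` is kept general because `2 * suc t` does not reduce to
-- `2 + 2 * t`.
odd-square⇒diagonal : ∀ {t n} → n ≡ suc (2 * t) → (W : Weights (suc n)) → (∀ i j → W i j ≤ 1) →
  (∀ i → sum (W i) ≡ suc t) → (∀ j → sum (λ i → W i j) ≡ suc t) → ∀ i j →
  (W zero zero + W zero (suc j)) + (W (suc i) zero + W (suc i) (suc j)) ≡ 1 →
  ∃[ π ] weight W π ≡ suc t
odd-square⇒diagonal {t} refl W W≤1 rows cols i j square≡1 = back (odd-corner⇒diagonal t
  (λ k l → W (ρ ⟨$⟩ʳ k) (γ ⟨$⟩ʳ l)) (λ _ _ → W≤1 _ _)
  (λ k → trans (sym (sum-permute (W (ρ ⟨$⟩ʳ k)) γ)) (rows _))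
  (λ l → trans (sym (sum-permute (λ k → W k (γ ⟨$⟩ʳ l)) ρ)) (cols _))
  (trans (cong₂ (λ x y → W zero zero + W zero (suc y) + (W (suc x) zero + W (suc x) (suc y)))
    (transposition-left zero i) (transposition-left zero j)) square≡1))
  where
  ρ = lift₀ (transposition zero i)
  γ = lift₀ (transposition zero j)
  back : ∃[ π ] weight (λ k l → W (ρ ⟨$⟩ʳ k) (γ ⟨$⟩ʳ l)) π ≡ suc t → ∃[ π ] weight W π ≡ suc t
  back (π , w≡) = flip ρ ∘ₚ π ∘ₚ γ , trans (weight-rearrange W ρ γ π) w≡

-- Counting symbols

indicator : Symbol → Symbol → ℕ
indicator s x = if does (x ≟ s) then 1 else 0

indicator≤1 : ∀ s x → indicator s x ≤ 1
indicator≤1 = from-yes (all? λ s → all? λ x → indicator s x ≤? 1)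

indicator-refl : ∀ s → indicator s s ≡ 1
indicator-refl = from-yes (all? λ s → indicator s s ℕ.≟ 1)

indicator-≢ : ∀ {s x} → x ≢ s → indicator s x ≡ 0
indicator-≢ {s} {x} x≢s with x ≟ s
... | yes x≡s = contradiction x≡s x≢s
... | no _    = refl

occurrences≡sum : ∀ {n} s (f : Fin n → Symbol) → occurrences s f ≡ sum (indicator s ∘ f)
occurrences≡sum {zero}  s f = refl
occurrences≡sum {suc n} s f with f zero ≟ s
... | yes _ = cong suc (occurrences≡sum s (f ∘ suc))
... | no _  = occurrences≡sum s (f ∘ suc)

occurrences-total : ∀ {n} (f : Fin n → Symbol) → occurrences s₁ f + occurrences s₂ f ≡ n
occurrences-total {zero}  f = refl
occurrences-total {suc n} f with f zero
... | s₁ = cong suc (occurrences-total (f ∘ suc))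
... | s₂ = trans (+-suc _ _) (cong suc (occurrences-total (f ∘ suc)))

-- The two counts add up to `2 * l`, so controlling one symbol is enough.
occurrences-half : ∀ {l} (f : Fin (2 * l) → Symbol) s → occurrences s f ≡ l →
                   ∀ s′ → occurrences s′ f ≡ l
occurrences-half f s₁ eq s₁ = eq
occurrences-half f s₂ eq s₂ = eq
occurrences-half {l} f s₁ eq s₂ = +-cancelˡ-≡ l _ _
  (trans (cong (_+ occurrences s₂ f) (sym eq))
  (trans (occurrences-total f) (cong (l +_) (+-identityʳ l))))
occurrences-half {l} f s₂ eq s₁ = +-cancelʳ-≡ l _ _
  (trans (cong (occurrences s₁ f +_) (sym eq))
  (trans (occurrences-total f) (cong (l +_) (+-identityʳ l))))

-- An occurrence of `g zero` in `f` is moved to the front and cancelled from both counts; the tails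
-- then match by induction.
matching : ∀ {n} (f g : Fin n → Symbol) → (∀ s → sum (indicator s ∘ f) ≡ sum (indicator s ∘ g)) →
           ∃[ ρ ] (∀ i → f (ρ ⟨$⟩ʳ i) ≡ g i)
matching {zero}  f g same = id , λ ()
matching {suc n} f g same with any? (λ i → f i ≟ g zero)
-- The symbol `g zero` occurs in `g`, so its count in `f` cannot be 0.
... | no absent = contradiction
  (trans (sym (trans (sum-cong-≗ (λ i → indicator-≢ (λ fi≡g0 → absent (i , fi≡g0))))
                     (trans (sum-const (suc n) 0) (*-zeroʳ n))))
  (trans (same (g zero)) (cong (_+ sum (indicator (g zero) ∘ g ∘ suc)) (indicator-refl (g zero)))))
  λ ()
... | yes (i , fi≡g0) = extend (matching (f ∘ (τ ⟨$⟩ʳ_) ∘ suc) (g ∘ suc) tails-same)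
  where
  open ≡-Reasoning
  τ = transposition zero i
  fτ0≡g0 : f (τ ⟨$⟩ʳ zero) ≡ g zero
  fτ0≡g0 = trans (cong f (transposition-left zero i)) fi≡g0
  tails-same : ∀ s → sum (indicator s ∘ f ∘ (τ ⟨$⟩ʳ_) ∘ suc) ≡ sum (indicator s ∘ g ∘ suc)
  tails-same s = +-cancelˡ-≡ (indicator s (g zero)) _ _ (begin
    indicator s (g zero) + sum (indicator s ∘ f ∘ (τ ⟨$⟩ʳ_) ∘ suc)
      ≡⟨ cong (λ x → indicator s x + sum (indicator s ∘ f ∘ (τ ⟨$⟩ʳ_) ∘ suc)) fτ0≡g0 ⟨
    sum (indicator s ∘ f ∘ (τ ⟨$⟩ʳ_))
      ≡⟨ sum-permute (indicator s ∘ f) τ ⟨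
    sum (indicator s ∘ f)
      ≡⟨ same s ⟩
    sum (indicator s ∘ g) ∎)
  extend : ∃[ ρ ] (∀ k → f (τ ⟨$⟩ʳ suc (ρ ⟨$⟩ʳ k)) ≡ g (suc k)) → ∃[ ρ ] (∀ k → f (ρ ⟨$⟩ʳ k) ≡ g k)
  extend (ρ , agree) = lift₀ ρ ∘ₚ τ , λ { zero → fτ0≡g0 ; (suc k) → agree k }

-- Symbols modulo 2 and the parity of 2 × 2 subarrays

infixl 6 _⊕_

_⊕_ : Symbol → Symbol → Symbol
s₁ ⊕ y  = y
s₂ ⊕ s₁ = s₂
s₂ ⊕ s₂ = s₁

⊕-comm : ∀ x y → x ⊕ y ≡ y ⊕ x
⊕-comm = from-yes (all? λ x → all? λ y → x ⊕ y ≟ y ⊕ x)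

⊕-involutiveʳ : ∀ x y → x ⊕ y ⊕ y ≡ x
⊕-involutiveʳ = from-yes (all? λ x → all? λ y → x ⊕ y ⊕ y ≟ x)

⊕-interchange : ∀ a a′ b b′ → (a ⊕ b) ⊕ (a′ ⊕ b′) ≡ (a ⊕ b′) ⊕ (a′ ⊕ b)
⊕-interchange = from-yes (all? λ a → all? λ a′ → all? λ b → all? λ b′ →
  (a ⊕ b) ⊕ (a′ ⊕ b′) ≟ (a ⊕ b′) ⊕ (a′ ⊕ b))

⊕-translate : ∀ c x y → (x ⊕ c) ⊕ (y ⊕ c) ≡ x ⊕ y
⊕-translate = from-yes (all? λ c → all? λ x → all? λ y → (x ⊕ c) ⊕ (y ⊕ c) ≟ x ⊕ y)

⊕-flip : ∀ x y → x ≢ y → y ≡ s₂ ⊕ x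
⊕-flip = from-yes (all? λ x → all? λ y → ¬? (x ≟ y) →-dec (y ≟ s₂ ⊕ x))

-- Turns an equation modulo 2 into evenness of an ordinary sum, which can then be added up along a
-- diagonal.
even-square : ∀ a b c d → d ⊕ a ≡ c ⊕ b → 2 ∣ (toℕ d + toℕ a) + (toℕ c + toℕ b)
even-square = from-yes (all? λ a → all? λ b → all? λ c → all? λ d →
  (d ⊕ a ≟ c ⊕ b) →-dec (2 ∣? (toℕ d + toℕ a) + (toℕ c + toℕ b)))

-- An odd square splits its four cells 3 to 1; the witness is the symbol that occurs once.
odd-square : ∀ a b c d → d ⊕ a ≢ c ⊕ b →
  ∃[ s ] (indicator s a + indicator s b) + (indicator s c + indicator s d) ≡ 1
odd-square = from-yes (all? λ a → all? λ b → all? λ c → all? λ d →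
  ¬? (d ⊕ a ≟ c ⊕ b) →-dec any? (λ s → (indicator s a + indicator s b) + (indicator s c + indicator s d) ℕ.≟ 1))

-- Both permutations of two symbols are translations modulo 2; injectivity of `σ` forces the image
-- of `s₂`.
permute-symbol : ∀ (σ : Permutation′ 2) x → σ ⟨$⟩ʳ x ≡ x ⊕ (σ ⟨$⟩ʳ s₁)
permute-symbol σ s₁ = refl
permute-symbol σ s₂ = ⊕-flip _ _ λ eq →
  case trans (sym (inverseˡ σ)) (trans (cong (σ ⟨$⟩ˡ_) eq) (inverseˡ σ)) of λ ()

-- _⊕_ is addition mod 2 with s₁ as 0, so this says that every 2 × 2 subarray
-- contains each symbol an even number of times.
EvenSquares : ∀ {n} → Array n → Set
EvenSquares L = ∀ i i′ j j′ → L i j ⊕ L i′ j′ ≡ L i j′ ⊕ L i′ j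

-- Goes from `M` back to `L` because a chain of steps ends at `A l`, where the property is known. A
-- relabelling adds the same constant to every cell, which cancels in pairs.
step-EvenSquares : ∀ {n} {L M : Array n} → Step L M → EvenSquares M → EvenSquares L
step-EvenSquares {L = L} (rearrangeRows ρ M≡) even i i′ j j′ =
  trans (sym (cong₂ _⊕_ (at i j) (at i′ j′)))
  (trans (even _ _ j j′) (cong₂ _⊕_ (at i j′) (at i′ j)))
  where
  at = λ i j → trans (M≡ (ρ ⟨$⟩ˡ i) j) (cong (λ x → L x j) (inverseʳ ρ))
step-EvenSquares {L = L} (rearrangeColumns γ M≡) even i i′ j j′ =
  trans (sym (cong₂ _⊕_ (at i j) (at i′ j′)))
  (trans (even i i′ _ _) (cong₂ _⊕_ (at i j′) (at i′ j)))
  where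
  at = λ i j → trans (M≡ i (γ ⟨$⟩ˡ j)) (cong (L i) (inverseʳ γ))
step-EvenSquares {L = L} {M} (relabelSymbols σ M≡) even i i′ j j′ =
  trans (sym (untranslate i j i′ j′)) (trans (even i i′ j j′) (untranslate i j′ i′ j))
  where
  at = λ i j → trans (M≡ i j) (permute-symbol σ (L i j))
  untranslate : ∀ i j i′ j′ → M i j ⊕ M i′ j′ ≡ L i j ⊕ L i′ j′
  untranslate i j i′ j′ = trans (cong₂ _⊕_ (at i j) (at i′ j′)) (⊕-translate (σ ⟨$⟩ʳ s₁) (L i j) (L i′ j′))
step-EvenSquares {L = L} (transpose M≡) even i i′ j j′ =
  trans (sym (cong₂ _⊕_ (M≡ j i) (M≡ j′ i′)))
  (trans (even j j′ i i′) (trans (cong₂ _⊕_ (M≡ j i′) (M≡ j′ i)) (⊕-comm (L i′ j) (L i j′))))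

-- The array `A` as a sum of row and column labels

label : ∀ {X Y : Set} → X ⊎ Y → Symbol
label (inj₁ _) = s₁
label (inj₂ _) = s₂

blockEntry≡⊕ : ∀ {X Y : Set} (u v : X ⊎ Y) → blockEntry u v ≡ label u ⊕ label v
blockEntry≡⊕ (inj₁ _) (inj₁ _) = refl
blockEntry≡⊕ (inj₁ _) (inj₂ _) = refl
blockEntry≡⊕ (inj₂ _) (inj₁ _) = refl
blockEntry≡⊕ (inj₂ _) (inj₂ _) = refl

A-EvenSquares : ∀ l → EvenSquares (A l)
A-EvenSquares l i i′ j j′
  rewrite blockEntry≡⊕ (splitAt l i) (splitAt l j) | blockEntry≡⊕ (splitAt l i′) (splitAt l j′)
        | blockEntry≡⊕ (splitAt l i) (splitAt l j′) | blockEntry≡⊕ (splitAt l i′) (splitAt l j)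
  = ⊕-interchange (label (splitAt l i)) (label (splitAt l i′)) (label (splitAt l j)) (label (splitAt l j′))

equivalent-A⇒EvenSquares : ∀ {l L} → Equivalent L (A l) → EvenSquares L
equivalent-A⇒EvenSquares {l} ε = A-EvenSquares l
equivalent-A⇒EvenSquares (step ◅ steps) = step-EvenSquares step (equivalent-A⇒EvenSquares steps)

sum-splitAt : ∀ m {n} (F : Fin m ⊎ Fin n → ℕ) →
              sum (λ k → F (splitAt m k)) ≡ sum (F ∘ inj₁) + sum (F ∘ inj₂)
sum-splitAt zero    F = refl
sum-splitAt (suc m) F = trans (cong (F (inj₁ zero) +_) (sum-splitAt m (F ∘ Sum.map suc (λ j → j))))
  (sym (+-assoc (F (inj₁ zero)) _ _))

-- Gives the block labels the same frequencies as a row or column of a frequency square, as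
-- `matching` requires.
label-frequency : ∀ l s → sum {2 * l} (λ k → indicator s (label (splitAt l k))) ≡ l
label-frequency l s = trans (sum-splitAt l (indicator s ∘ label)) (counts s)
  where
  counts : ∀ s → sum {l} (const (indicator s s₁)) + sum {l + 0} (const (indicator s s₂)) ≡ l
  counts s₁ = trans (cong₂ _+_ (sum-const l 1) (sum-const (l + 0) 0))
    (trans (cong₂ _+_ (*-identityʳ l) (*-zeroʳ (l + 0))) (+-identityʳ l))
  counts s₂ = trans (cong₂ _+_ (sum-const l 0) (sum-const (l + 0) 1))
    (trans (cong₂ _+_ (*-zeroʳ l) (*-identityʳ (l + 0))) (+-identityʳ l))

-- Balanced diagonals of a frequency square

∣-sum : ∀ {n d} {f : Fin n → ℕ} → (∀ i → d ∣ f i) → d ∣ sum f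
∣-sum {zero}  {d} d∣f = d ∣0
∣-sum {suc n} d∣f = ∣m∣n⇒∣m+n (d∣f zero) (∣-sum (d∣f ∘ suc))

module _ (t : ℕ) (L : Array (2 * suc t)) (L-fs : IsFrequencySquare (suc t) L) where

  open IsFrequencySquare L-fs

  private
    l = suc t

    W : Symbol → Weights (2 * l)
    W s i j = indicator s (L i j)

    W≤1 : ∀ s i j → W s i j ≤ 1
    W≤1 s i j = indicator≤1 s (L i j)

    W-rows : ∀ s i → sum (W s i) ≡ l
    W-rows s i = trans (sym (occurrences≡sum s (L i))) (rows i s)

    W-columns : ∀ s j → sum (λ i → W s i j) ≡ l
    W-columns s j = trans (sym (occurrences≡sum s (λ i → L i j))) (columns j s)

    W-total : ∀ s → total (W s) ≡ 2 * l * l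
    W-total s = trans (sum-cong-≗ (W-rows s)) (sum-const (2 * l) l)

    side : Fin (2 * l) → Symbol
    side k = label (splitAt l k)

    -- Squares through the cell `(zero , zero)` are enough: they already express `L i j` through the
    -- first row and the first column.
    EvenAt0 : Set
    EvenAt0 = ∀ i j → L i j ⊕ L zero zero ≡ L i zero ⊕ L zero j

  weight≡l⇒balanced : ∀ {s} π → weight (W s) π ≡ l → Balanced l L π
  weight≡l⇒balanced {s} π w≡l =
    occurrences-half diagonal s (trans (occurrences≡sum s diagonal) w≡l)
    where
    diagonal : Fin (2 * l) → Symbol
    diagonal i = L i (π ⟨$⟩ʳ i)

  odd-square⇒balanced : ∀ {i j} → L i j ⊕ L zero zero ≢ L i zero ⊕ L zero j →
                        HasBalancedDiagonal l L
  -- A degenerate square, with `i` or `j` zero, is always even.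
  odd-square⇒balanced {zero}  {j}     odd = contradiction (⊕-comm (L zero j) _) odd
  odd-square⇒balanced {suc i} {zero}  odd = contradiction refl odd
  odd-square⇒balanced {suc i} {suc j} odd
    with s , square≡1 ← odd-square (L zero zero) (L zero (suc j)) (L (suc i) zero) (L (suc i) (suc j)) odd
    with π , w≡l ← odd-square⇒diagonal {t} (+-suc t (t + 0)) (W s) (W≤1 s) (W-rows s) (W-columns s) i j square≡1
    = π , weight≡l⇒balanced π w≡l

  -- Add up the even squares spanned by `(zero , zero)` and the cells `(i , π i)`. The first row and
  -- first column contribute `l` each and the fixed cell `2 * l * c`, all together even, so the
  -- diagonal's share is even too.
  diagonal-even : EvenAt0 → ∀ π → 2 ∣ weight (W s₂) π
  diagonal-even even π = ∣m+n∣m⇒∣n (subst (2 ∣_) reorder (∣-sum all-even)) even-part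
    where
    open ≡-Reasoning
    c = W s₂ zero zero
    toℕ≡indicator : ∀ x → toℕ x ≡ indicator s₂ x
    toℕ≡indicator = from-yes (all? λ x → toℕ x ℕ.≟ indicator s₂ x)
    d r k : Fin (2 * l) → ℕ
    d i = W s₂ i (π ⟨$⟩ʳ i)
    r i = W s₂ i zero
    k i = W s₂ zero (π ⟨$⟩ʳ i)
    all-even : ∀ i → 2 ∣ (d i + c) + (r i + k i)
    all-even i = subst (2 ∣_)
      (cong₂ _+_ (cong₂ _+_ (toℕ≡indicator (L i (π ⟨$⟩ʳ i))) (toℕ≡indicator (L zero zero)))
                 (cong₂ _+_ (toℕ≡indicator (L i zero)) (toℕ≡indicator (L zero (π ⟨$⟩ʳ i)))))
      (even-square (L zero zero) (L zero (π ⟨$⟩ʳ i)) (L i zero) (L i (π ⟨$⟩ʳ i)) (even i (π ⟨$⟩ʳ i)))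
    even-part : 2 ∣ 2 * l * c + 2 * l
    even-part = ∣m∣n⇒∣m+n (∣m⇒∣m*n c (m∣m*n l)) (m∣m*n l)
    reorder : sum (λ i → (d i + c) + (r i + k i)) ≡ (2 * l * c + 2 * l) + weight (W s₂) π
    reorder = begin
      sum (λ i → (d i + c) + (r i + k i))
        ≡⟨ ∑-distrib-+ (λ i → d i + c) (λ i → r i + k i) ⟩
      sum (λ i → d i + c) + sum (λ i → r i + k i)
        ≡⟨ cong₂ _+_ (∑-distrib-+ d (const c)) (∑-distrib-+ r k) ⟩
      (sum d + sum {2 * l} (const c)) + (sum r + sum k)
        ≡⟨ cong₂ _+_ (cong (sum d +_) (sum-const (2 * l) c))
             (cong₂ _+_ (W-columns s₂ zero)
               (trans (sym (sum-permute (W s₂ zero) π)) (W-rows s₂ zero))) ⟩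
      (sum d + 2 * l * c) + (l + l)
        ≡⟨ shuffle (sum d) (2 * l * c) l ⟩
      (2 * l * c + 2 * l) + sum d ∎
      where
      shuffle : ∀ x y l → (x + y) + (l + l) ≡ (y + 2 * l) + x
      shuffle = solve-∀

  -- All diagonal weights are even, so one in {l, l + 1} equals the even l.
  even-order⇒balanced : EvenAt0 → 2 ∣ l → HasBalancedDiagonal l L
  even-order⇒balanced even 2∣l
    with π , l≤w , w≤l+1 ← near-exists (W≤1 s₂) l
      (subst (λ T → 2 * l * l < T + 2 * l) (sym (W-total s₂)) (m<m+n (2 * l * l) (s≤s z≤n)))
      (subst (_< 2 * l * (2 + l)) (sym (W-total s₂)) (*-monoʳ-< (2 * l) (m<n+m l {2} (s≤s z≤n))))
    = π , weight≡l⇒balanced π (exact π l≤w w≤l+1)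
    where
    exact : ∀ π → l ≤ weight (W s₂) π → weight (W s₂) π ≤ suc l → weight (W s₂) π ≡ l
    exact π l≤w w≤l+1 with weight (W s₂) π ≤? l
    ... | yes w≤l = ≤-antisym w≤l l≤w
    -- Weight `l + 1` would make both `l` and `l + 1` even.
    ... | no  w≰l = contradiction
      (∣1⇒≡1 (∣m+n∣m⇒∣n (subst (2 ∣_) (trans (≤-antisym w≤l+1 (≰⇒> w≰l)) (+-comm 1 l))
                                    (diagonal-even even π)) 2∣l)) λ ()

  -- Rearrange so that the old first column and first row read as the block labels. By `even`, the
  -- resulting array differs from `A l` only by the constant `c`, which a relabelling absorbs.
  EvenAt0⇒equivalent : EvenAt0 → Equivalent L (A l)
  EvenAt0⇒equivalent even
    with ρ , ρ≡ ← matching (λ i → L i zero) side (λ s → trans (W-columns s zero) (sym (label-frequency l s)))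
    with γ , γ≡ ← matching (L zero) side (λ s → trans (W-rows s zero) (sym (label-frequency l s)))
    = rearrangeRows {M = λ i j → L (ρ ⟨$⟩ʳ i) j} ρ (λ _ _ → refl)
    ◅ rearrangeColumns {M = λ i j → L (ρ ⟨$⟩ʳ i) (γ ⟨$⟩ʳ j)} γ (λ _ _ → refl)
    ◅ relabelSymbols translation (λ i j → trans (blockEntry≡⊕ (splitAt l i) (splitAt l j))
        (trans (sym (cong₂ _⊕_ (ρ≡ i) (γ≡ j))) (sym (even (ρ ⟨$⟩ʳ i) (γ ⟨$⟩ʳ j)))))
    ◅ ε
    where
    c = L zero zero
    translation : Permutation′ 2
    translation = permutation (_⊕ c) (_⊕ c) (λ x → ⊕-involutiveʳ x c) (λ x → ⊕-involutiveʳ x c)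

  inequivalent⇒balanced : ¬ (Odd l × Equivalent L (A l)) → HasBalancedDiagonal l L
  inequivalent⇒balanced inequivalent
    with any? (λ i → any? (λ j → ¬? (L i j ⊕ L zero zero ≟ L i zero ⊕ L zero j)))
  ... | yes (i , j , odd) = odd-square⇒balanced odd
  ... | no  none = by-parity (2 ∣? l)
    where
    even : EvenAt0
    even i j = decidable-stable (_ ≟ _) (λ odd → none (i , j , odd))
    by-parity : Dec (2 ∣ l) → HasBalancedDiagonal l L
    by-parity (yes 2∣l) = even-order⇒balanced even 2∣l
    by-parity (no  2∤l) = contradiction (2∤l , EvenAt0⇒equivalent even) inequivalent

  -- A balanced diagonal would carry `s₂` exactly `l` times, but even squares make that number even.
  equivalent⇒unbalanced : Odd l × Equivalent L (A l) → ¬ HasBalancedDiagonal l L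
  equivalent⇒unbalanced (l-odd , L~A) (π , balanced) = l-odd (subst (2 ∣_)
    (trans (sym (occurrences≡sum s₂ (λ i → L i (π ⟨$⟩ʳ i)))) (balanced s₂))
    (diagonal-even (λ i j → equivalent-A⇒EvenSquares L~A i zero j zero) π))

theorem2 : (l : ℕ) → 1 ≤ l → (L : Array (2 * l)) → IsFrequencySquare l L →
    (¬ (Odd l × Equivalent L (A l)) → HasBalancedDiagonal l L) ×
    (Odd l × Equivalent L (A l) → ¬ HasBalancedDiagonal l L)
theorem2 (suc t) _ L L-fs = inequivalent⇒balanced t L L-fs , equivalent⇒unbalanced t L L-fs
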